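{- For all $n$, $|\mathsf{ASM}_n(3412)|\le 62208^n$, and likewise $|\mathsf{ASM}_n(2143)|\le 62208^n$.
   Context: An alternating sign matrix (ASM) is a square matrix with entries in $\{0,1,-1\}$ such that every row and every column sums to $1$ and the nonzero entries of each row and each column alternate in sign. A permutation $\pi\in S_k$ is identified with the $k\times k$ matrix whose row $i$ has a $1$ in column $\pi(i)$ and $0$ elsewhere. An $n\times n$ ASM $A$ classically contains $\pi\in S_k$ if there are order-preserving injections $f,g:[k]\to[n]$ with $A_{f(i),g(\pi(i))}=1$ for all $i$; otherwise $A$ classically avoids $\pi$. $\mathsf{ASM}_n(\sigma)$ denotes the set of $n\times n$ ASMs classically avoiding $\sigma$. -}

module Defs where

open import Data.Nat using (ℕ; zero; suc; _^_)
open import Data.Fin using (Fin; zero; suc; _<_)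
open import Data.Integer using (ℤ; +_; -[1+_]; _+_)
open import Data.Product using (Σ; _×_; ∃)
open import Data.Empty using (⊥)
open import Relation.Nullary using (¬_)
open import Relation.Binary.PropositionalEquality using (_≡_; _≢_)

data Entry : Set where
  e0 e1 em1 : Entry

val : Entry → ℤ
val e0  = + 0
val e1  = + 1
val em1 = -[1+ 0 ]

NonZero : Entry → Set
NonZero e = e ≢ e0

Matrix : ℕ → Set
Matrix n = Fin n → Fin n → Entry

sumFin : ∀ n → (Fin n → ℤ) → ℤ
sumFin zero    f = + 0
sumFin (suc n) f = f zero + sumFin n (λ i → f (suc i))

Alternating : ∀ {n} → (Fin n → Entry) → Set
Alternating {n} s =
  ∀ (j k : Fin n) → j < k → NonZero (s j) → NonZero (s k) →
  (∀ (l : Fin n) → j < l → l < k → s l ≡ e0) → s j ≢ s k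

record IsASM {n : ℕ} (A : Matrix n) : Set where
  field
    rowSum : ∀ i → sumFin n (λ j → val (A i j)) ≡ + 1
    colSum : ∀ j → sumFin n (λ i → val (A i j)) ≡ + 1
    rowAlt : ∀ i → Alternating (λ j → A i j)
    colAlt : ∀ j → Alternating (λ i → A i j)

Increasing : ∀ {k n} → (Fin k → Fin n) → Set
Increasing {k} f = ∀ (i j : Fin k) → i < j → f i < f j

-- Classical containment of a permutation π ∈ S_k (given as a map Fin k → Fin k)
Contains : ∀ {n k} → Matrix n → (Fin k → Fin k) → Set
Contains {n} {k} A π =
  Σ (Fin k → Fin n) λ f → Σ (Fin k → Fin n) λ g →
    Increasing f × Increasing g × (∀ i → A (f i) (g (π i)) ≡ e1)

Avoids : ∀ {n k} → Matrix n → (Fin k → Fin k) → Set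
Avoids A π = ¬ Contains A π

p3412 : Fin 4 → Fin 4
p3412 zero                   = suc (suc zero)
p3412 (suc zero)             = suc (suc (suc zero))
p3412 (suc (suc zero))       = zero
p3412 (suc (suc (suc zero))) = suc zero

p2143 : Fin 4 → Fin 4
p2143 zero                   = suc zero
p2143 (suc zero)             = zero
p2143 (suc (suc zero))       = suc (suc (suc zero))
p2143 (suc (suc (suc zero))) = suc (suc zero)

InASMAvoiding : ∀ {k} n → (Fin k → Fin k) → Matrix n → Set
InASMAvoiding n σ A = IsASM A × Avoids A σ

_≈M_ : ∀ {n} → Matrix n → Matrix n → Set
A ≈M B = ∀ i j → A i j ≡ B i j

CardAtMost : ∀ {n} → (Matrix n → Set) → ℕ → Set
CardAtMost {n} P N =
  Σ (Matrix n → Fin N) λ f →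
    ∀ A B → P A → P B → f A ≡ f B → A ≈M B

{-# OPTIONS --safe #-}
module Submission where

-- Every −1 has a 1 on each of its four sides, so avoiding 3412 forbids two −1s in strict NE/SW
-- position: the −1s form a chain running weakly from NW to SE. A chain is determined by bounded
-- labels of its rows and columns. A 1 is then either rightmost in its row and topmost in its column,
-- or leftmost and lowest, or lies between two −1s of its row or column, in which case a label of its
-- column or row and the −1s locate it. The first two kinds form partial permutation matrices avoiding
-- 3412; each splits into four classes that are determined by their nonempty rows and columns.
-- With 240 labels for a row and 240 for a column this gives 240² = 57600 ≤ 62208 codes per index.
-- The pattern 2143 is the mirror image of 3412.

open import Defs
open import Data.Nat using (ℕ; _^_; zero; suc; z<s; s<s; s<s⁻¹) renaming (_<_ to _<ⁿ_)
open import Data.Product using (_×_; ∃; ∃₂; _,_; proj₁; proj₂)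

import Data.Nat.Properties as ℕ
open import Data.Empty using (⊥; ⊥-elim)
open import Data.Fin using (Fin; zero; suc; _<_; _>_; combine; inject≤; funToFin; finToFun; opposite)
open import Data.Fin.Induction using (<-wellFounded; >-wellFounded)
open import Data.Fin.Permutation using (reverse)
open import Data.Fin.Properties
  using (any?; _<?_; _≟_; <-cmp; <-trans; <-irrefl; combine-injective; inject≤-injective;
         finToFun-funToFin; opposite-involutive; opposite-prop; toℕ<n)
open import Data.Integer using (ℤ; +_; -[1+_]; _+_)
import Data.Integer.Properties as ℤ
open import Algebra.Properties.CommutativeMonoid.Sum ℤ.+-0-commutativeMonoid using (sum; sum-permute)
open import Data.Sum using (_⊎_; inj₁; inj₂; [_,_]′)
open import Function using (_∘_)
open import Induction.WellFounded using (Acc; acc)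
open import Relation.Binary.Definitions using (tri<; tri≈; tri>)
open import Relation.Binary.PropositionalEquality
  using (_≡_; _≢_; refl; sym; trans; cong; subst; subst₂)
open import Relation.Nullary using (¬_; Dec; yes; no; contradiction)
open import Relation.Nullary.Decidable using (_×-dec_; ¬?; toWitness)

private variable
  n m : ℕ

-- Sets of cells and their extreme cells

Cells : ℕ → Set₁
Cells n = Fin n → Fin n → Set

infix 30 _ᵀ

_ᵀ : ∀ {ℓ} {B : Set ℓ} → (Fin n → Fin n → B) → Fin n → Fin n → B
(A ᵀ) i j = A j i

_⊑_ : Cells n → Cells n → Set
X ⊑ Y = ∀ {i j} → X i j → Y i j

Decidable₂ : Cells n → Set
Decidable₂ X = ∀ i j → Dec (X i j)

Up Down Left Right : Cells n → Cells n
Up    X i j = ∃ λ k → k < i × X k j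
Down  X i j = ∃ λ k → i < k × X k j
Left  X = Up (X ᵀ) ᵀ
Right X = Down (X ᵀ) ᵀ

NEof SWof : Cells n → Cells n
NEof X i j = ∃₂ λ k l → (k < i × j < l) × X k l
SWof X i j = ∃₂ λ k l → (i < k × l < j) × X k l

module _ {X : Cells n} (X? : Decidable₂ X) where

  up? : Decidable₂ (Up X)
  up? i j = any? λ k → (k <? i) ×-dec X? k j

  down? : Decidable₂ (Down X)
  down? i j = any? λ k → (i <? k) ×-dec X? k j

  NEof? : Decidable₂ (NEof X)
  NEof? i j = any? λ k → any? λ l → ((k <? i) ×-dec (j <? l)) ×-dec X? k l

  SWof? : Decidable₂ (SWof X)
  SWof? i j = any? λ k → any? λ l → ((i <? k) ×-dec (l <? j)) ×-dec X? k l

module _ {X : Cells n} (X? : Decidable₂ X) where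

  left? : Decidable₂ (Left X)
  left? i j = up? (λ k l → X? l k) j i

  right? : Decidable₂ (Right X)
  right? i j = down? (λ k l → X? l k) j i

upmost-unique : {X : Cells n} → ∀ {i k j} → X i j → ¬ Up X i j → X k j → ¬ Up X k j → i ≡ k
upmost-unique {i = i} {k} x ¬u y ¬v with <-cmp i k
... | tri< i<k _ _ = contradiction (i , i<k , x) ¬v
... | tri≈ _ e _ = e
... | tri> _ _ k<i = contradiction (k , k<i , y) ¬u

downmost-unique : {X : Cells n} → ∀ {i k j} → X i j → ¬ Down X i j → X k j → ¬ Down X k j → i ≡ k
downmost-unique {i = i} {k} x ¬u y ¬v with <-cmp i k
... | tri< i<k _ _ = contradiction (k , i<k , y) ¬u
... | tri≈ _ e _ = e
... | tri> _ _ k<i = contradiction (i , k<i , x) ¬v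

topmost : {X : Cells n} → Decidable₂ X → ∀ {i j} → X i j →
  ∃ λ t → X t j × ¬ Up X t j × (t ≡ i ⊎ t < i)
topmost {X = X} X? {i} {j} = go (<-wellFounded i)
  where
  go : ∀ {i} → Acc _<_ i → X i j → ∃ λ t → X t j × ¬ Up X t j × (t ≡ i ⊎ t < i)
  go {i} (acc rs) x with up? X? i j
  ... | no ¬u = i , x , ¬u , inj₁ refl
  ... | yes (k , k<i , y) with go (rs k<i) y
  ... | t , z , ¬u , inj₁ refl = t , z , ¬u , inj₂ k<i
  ... | t , z , ¬u , inj₂ t<k = t , z , ¬u , inj₂ (<-trans {i = t} {k} t<k k<i)

bottommost : {X : Cells n} → Decidable₂ X → ∀ {i j} → X i j →
  ∃ λ t → X t j × ¬ Down X t j × (t ≡ i ⊎ i < t)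
bottommost {X = X} X? {i} {j} = go (>-wellFounded i)
  where
  go : ∀ {i} → Acc _>_ i → X i j → ∃ λ t → X t j × ¬ Down X t j × (t ≡ i ⊎ i < t)
  go {i} (acc rs) x with down? X? i j
  ... | no ¬u = i , x , ¬u , inj₁ refl
  ... | yes (k , i<k , y) with go (rs i<k) y
  ... | t , z , ¬u , inj₁ refl = t , z , ¬u , inj₂ i<k
  ... | t , z , ¬u , inj₂ k<t = t , z , ¬u , inj₂ (<-trans {i = i} {k} i<k k<t)

-- Partial permutation matrices with prescribed nonempty rows and columns

record IsPartialPerm (X : Cells n) : Set where
  field
    row-unique : ∀ {i j k} → X i j → X i k → j ≡ k
    col-unique : ∀ {i j k} → X i k → X j k → i ≡ j
open IsPartialPerm

record Covers (X Y : Cells n) : Set where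
  field
    row : ∀ {i j} → X i j → ∃ λ k → Y i k
    col : ∀ {i j} → X i j → ∃ λ k → Y k j
open Covers

-- What a first differing row `i` would produce: `X` and `Y` have their cells there in columns `j`
-- and `k`, and each meets the other's column further down.
NoExchange : Cells n → Cells n → Set
NoExchange X Y = ∀ {i a b j k} → i < a → i < b → j < k →
  X i j → X a k → Y i k → Y b j → ⊥

partialPermᵀ : {X : Cells n} → IsPartialPerm X → IsPartialPerm (X ᵀ)
partialPermᵀ p = record { row-unique = col-unique p ; col-unique = row-unique p }

coversᵀ : {X Y : Cells n} → Covers X Y → Covers (X ᵀ) (Y ᵀ)
coversᵀ c = record { row = col c ; col = row c }

module _ {X Y : Cells n} (pX : IsPartialPerm X) (pY : IsPartialPerm Y) (X→Y : Covers X Y) where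

  -- `Y` must meet column `j` somewhere. It cannot do so above row `i`, where its cells are cells of
  -- `X` and `X` uses column `j` in row `i`, nor in row `i`, where its only cell is in column `k`.
  covered-below : ∀ {i j k} → (∀ {a} → a < i → ∀ {j} → Y a j → X a j) →
    X i j → Y i k → j ≢ k → ∃ λ b → i < b × Y b j
  covered-below {i} IH x y j≢k with col X→Y x
  ... | b , z with <-cmp i b
  ... | tri< i<b _ _ = b , i<b , z
  ... | tri≈ _ refl _ = contradiction (row-unique pY z y) j≢k
  ... | tri> _ _ b<i = ⊥-elim (<-irrefl (col-unique pX (IH b<i z) x) b<i)

module _ {X Y : Cells n} (pX : IsPartialPerm X) (pY : IsPartialPerm Y)
  (X→Y : Covers X Y) (Y→X : Covers Y X) (nXY : NoExchange X Y) (nYX : NoExchange Y X) where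

  next-row-⊑ : ∀ {i} → (∀ {a} → a < i → ∀ {j} → X a j → Y a j) →
    (∀ {a} → a < i → ∀ {j} → Y a j → X a j) → ∀ {j} → X i j → Y i j
  next-row-⊑ {i} IHX IHY {j} x with row X→Y x
  ... | k , y with <-cmp j k
  ... | tri≈ _ refl _ = y
  ... | tri< j<k j≢k _
    with covered-below pX pY X→Y IHY x y j≢k | covered-below pY pX Y→X IHX y x (j≢k ∘ sym)
  ... | b , i<b , z | a , i<a , w = ⊥-elim (nXY i<a i<b j<k x w y z)
  next-row-⊑ {i} IHX IHY {j} x | k , y | tri> _ j≢k k<j
    with covered-below pX pY X→Y IHY x y j≢k | covered-below pY pX Y→X IHX y x (j≢k ∘ sym)
  ... | b , i<b , z | a , i<a , w = ⊥-elim (nYX i<b i<a k<j y z x w)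

module _ {X Y : Cells n} (pX : IsPartialPerm X) (pY : IsPartialPerm Y)
  (X→Y : Covers X Y) (Y→X : Covers Y X) (nXY : NoExchange X Y) (nYX : NoExchange Y X) where

  -- A row can be compared only once both inclusions are known in all earlier rows, so the two are
  -- proved in one induction from the top.
  covers⇒⊑ : X ⊑ Y
  covers⇒⊑ {i} = proj₁ (go (<-wellFounded i))
    where
    go : ∀ {i} → Acc _<_ i → (∀ {j} → X i j → Y i j) × (∀ {j} → Y i j → X i j)
    go (acc rs) =
      next-row-⊑ pX pY X→Y Y→X nXY nYX (λ a<i → proj₁ (go (rs a<i))) (λ a<i → proj₂ (go (rs a<i))) ,
      next-row-⊑ pY pX Y→X X→Y nYX nXY (λ a<i → proj₂ (go (rs a<i))) (λ a<i → proj₁ (go (rs a<i)))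

Chain : Cells n → Set
Chain X = ∀ {i j k l} → i < k → l < j → X i j → X k l → ⊥

chain-⊑ : {X Y : Cells n} → X ⊑ Y → Chain Y → Chain X
chain-⊑ f ch i<k l<j x y = ch i<k l<j (f x) (f y)

chain⇒noExchange : {X Y : Cells n} → Chain Y → NoExchange X Y
chain⇒noExchange ch _ i<b j<k _ _ y z = ch i<b j<k y z

covered-chains : {X Y : Cells n} → IsPartialPerm X → IsPartialPerm Y → Chain X → Chain Y →
  Covers X Y → Covers Y X → X ⊑ Y
covered-chains pX pY cX cY X→Y Y→X =
  covers⇒⊑ pX pY X→Y Y→X (chain⇒noExchange cY) (chain⇒noExchange cX)

-- Avoiding 3412

Avoids3412 : Cells n → Set
Avoids3412 X = ∀ {r₀ r₁ r₂ r₃ c₀ c₁ c₂ c₃} →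
  r₀ < r₁ → r₁ < r₂ → r₂ < r₃ → c₀ < c₁ → c₁ < c₂ → c₂ < c₃ →
  X r₀ c₂ → X r₁ c₃ → X r₂ c₀ → X r₃ c₁ → ⊥

-- The permutation 3412 is an involution, so its matrix is symmetric.
avoids3412ᵀ : {X : Cells n} → Avoids3412 X → Avoids3412 (X ᵀ)
avoids3412ᵀ av r₀₁ r₁₂ r₂₃ c₀₁ c₁₂ c₂₃ x₀ x₁ x₂ x₃ =
  av c₀₁ c₁₂ c₂₃ r₀₁ r₁₂ r₂₃ x₂ x₃ x₀ x₁

avoids3412-⊑ : {X Y : Cells n} → X ⊑ Y → Avoids3412 Y → Avoids3412 X
avoids3412-⊑ f av r₀₁ r₁₂ r₂₃ c₀₁ c₁₂ c₂₃ x₀ x₁ x₂ x₃ =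
  av r₀₁ r₁₂ r₂₃ c₀₁ c₁₂ c₂₃ (f x₀) (f x₁) (f x₂) (f x₃)

-- A cell is red when it plays the 1 of a 341; when X avoids 3412, it then has no ascent to its SW.
-- Blue cells have no ascent to their NE, whether or not X avoids 3412.
module Shading {X : Cells n} (X? : Decidable₂ X) where

  Red : Cells n
  Red i j = ∃₂ λ k l → ∃₂ λ k′ l′ →
    ((k < k′ × k′ < i) × (j < l × l < l′)) × (X k l × X k′ l′)

  Red? : Decidable₂ Red
  Red? i j = any? λ k → any? λ l → any? λ k′ → any? λ l′ →
    (((k <? k′) ×-dec (k′ <? i)) ×-dec ((j <? l) ×-dec (l <? l′))) ×-dec (X? k l ×-dec X? k′ l′)

  RedX BlueX : Cells n
  RedX  i j = X i j × Red i j
  BlueX i j = X i j × ¬ Red i j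

  NEred? : Decidable₂ (NEof RedX)
  NEred? = NEof? λ i j → X? i j ×-dec Red? i j

  SWblue? : Decidable₂ (SWof BlueX)
  SWblue? = SWof? λ i j → X? i j ×-dec ¬? (Red? i j)

  -- Shades 0 and 2 pick out the outermost red and blue cells of `X`. These form chains and anchor
  -- the comparison of shades 1 and 3.
  Shade : Fin 4 → Cells n
  Shade zero                   i j = Red i j × ¬ NEof RedX i j
  Shade (suc zero)             i j = Red i j × NEof RedX i j
  Shade (suc (suc zero))       i j = ¬ Red i j × ¬ SWof BlueX i j
  Shade (suc (suc (suc zero))) i j = ¬ Red i j × SWof BlueX i j

  classify : ∀ i j → ∃ λ c → Shade c i j
  classify i j with Red? i j | NEred? i j | SWblue? i j
  ... | yes r | no ¬m | _     = zero , r , ¬m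
  ... | yes r | yes m | _     = suc zero , r , m
  ... | no ¬r | _     | no ¬m = suc (suc zero) , ¬r , ¬m
  ... | no ¬r | _     | yes m = suc (suc (suc zero)) , ¬r , m

  shade : Fin n → Fin n → Fin 4
  shade i j = proj₁ (classify i j)

  -- Testing the value of `shade` rather than the predicate `Shade` makes distinct classes disjoint
  -- by equality alone.
  Class : Fin 4 → Cells n
  Class c i j = X i j × shade i j ≡ c

  Class? : ∀ c → Decidable₂ (Class c)
  Class? c i j = X? i j ×-dec (shade i j ≟ c)

  class-shade : ∀ {c i j} → Class c i j → Shade c i j
  class-shade {i = i} {j} (_ , refl) = proj₂ (classify i j)

  -- Moving NE through red cells lowers the row, so the walk stops at an outermost one. The blue
  -- analogue walks SW and is measured by the column.
  maximal-red : ∀ {i j} → NEof RedX i j → NEof (Class zero) i j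
  maximal-red {i} = go (<-wellFounded i)
    where
    go : ∀ {i j} → Acc _<_ i → NEof RedX i j → NEof (Class zero) i j
    go (acc rs) (k , l , (k<i , j<l) , x , r) with shade k l in e | proj₂ (classify k l)
    ... | zero | _ = k , l , (k<i , j<l) , x , e
    ... | suc (suc zero) | ¬r , _ = contradiction r ¬r
    ... | suc (suc (suc zero)) | ¬r , _ = contradiction r ¬r
    ... | suc zero | _ , m with go (rs k<i) m
    ... | k′ , l′ , (k′<k , l<l′) , c = k′ , l′ , (ℕ.<-trans k′<k k<i , ℕ.<-trans j<l l<l′) , c

  maximal-blue : ∀ {i j} → SWof BlueX i j → SWof (Class (suc (suc zero))) i j
  maximal-blue {j = j} = go (<-wellFounded j)
    where
    go : ∀ {i j} → Acc _<_ j → SWof BlueX i j → SWof (Class (suc (suc zero))) i j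
    go (acc rs) (k , l , (i<k , l<j) , x , ¬r) with shade k l in e | proj₂ (classify k l)
    ... | zero | r , _ = contradiction r ¬r
    ... | suc zero | r , _ = contradiction r ¬r
    ... | suc (suc zero) | _ = k , l , (i<k , l<j) , x , e
    ... | suc (suc (suc zero)) | _ , m with go (rs l<j) m
    ... | k′ , l′ , (k<k′ , l′<l) , c = k′ , l′ , (ℕ.<-trans i<k k<k′ , ℕ.<-trans l′<l l<j) , c

  class-perm : IsPartialPerm X → ∀ c → IsPartialPerm (Class c)
  class-perm p c = record
    { row-unique = λ (x , _) (y , _) → row-unique p x y
    ; col-unique = λ (x , _) (y , _) → col-unique p x y
    }

  class₀-chain : Chain (Class zero)
  class₀-chain i<k l<j a b =
    proj₂ (class-shade b) (_ , _ , (i<k , l<j) , proj₁ a , proj₁ (class-shade a))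

  class₂-chain : Chain (Class (suc (suc zero)))
  class₂-chain i<k l<j a b =
    proj₂ (class-shade a) (_ , _ , (i<k , l<j) , proj₁ b , proj₁ (class-shade b))

open Shading using (Class; class-shade; class-perm; class₀-chain; class₂-chain; maximal-red; maximal-blue)

module _ {X Y : Cells n} (X? : Decidable₂ X) (Y? : Decidable₂ Y) where

  -- The cell of `Y` in row `i` has an outermost red cell of `Y` to its NE, which is also red in
  -- `X`. The ascent of `X` that makes it red, followed by the ascent `x`, `x′` below and to the
  -- left, is a 3412 in `X`.
  noExchange-red : Avoids3412 X → Class Y? zero ⊑ Class X? zero →
    NoExchange (Class X? (suc zero)) (Class Y? (suc zero))
  noExchange-red av Y⊑X {i} {a} {b} {j} {k} i<a _ j<k (x , _) (x′ , _) y _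
    with maximal-red Y? (proj₂ (class-shade Y? y))
  ... | s , t , (s<i , k<t) , c with class-shade X? (Y⊑X c)
  ... | (_ , _ , _ , _ , ((p , q) , (u , v)) , w , w′) , _ =
    av p (ℕ.<-trans q s<i) i<a j<k (ℕ.<-trans k<t u) v w w′ x x′

  -- An outermost blue cell SW of the cell `y` of `Y` is also blue in `X`. Scanning columns puts `y`
  -- at the lower left corner of the rectangle spanned by the ascent `x`, `x′` of `X`, so this
  -- ascent lies NE of the blue cell and would make it red. Scanning rows would put `y` at the upper
  -- right corner.
  noExchange-blue : Class Y? (suc (suc zero)) ⊑ Class X? (suc (suc zero)) →
    NoExchange (Class X? (suc (suc (suc zero))) ᵀ) (Class Y? (suc (suc (suc zero))) ᵀ)
  noExchange-blue Y⊑X i<a _ j<k (x , _) (x′ , _) y _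
    with maximal-blue Y? (proj₂ (class-shade Y? y))
  ... | s , t , (k<s , t<i) , c =
    proj₁ (class-shade X? (Y⊑X c)) (_ , _ , _ , _ , ((j<k , k<s) , (t<i , i<a)) , x , x′)

module _ {X Y : Cells n} (X? : Decidable₂ X) (Y? : Decidable₂ Y)
  (pX : IsPartialPerm X) (pY : IsPartialPerm Y)
  (X→Y : ∀ c → Covers (Class X? c) (Class Y? c)) (Y→X : ∀ c → Covers (Class Y? c) (Class X? c)) where

  covered-class₀ : Class X? zero ⊑ Class Y? zero
  covered-class₀ = covered-chains (class-perm X? pX _) (class-perm Y? pY _)
    (class₀-chain X?) (class₀-chain Y?) (X→Y _) (Y→X _)

  covered-class₂ : Class X? (suc (suc zero)) ⊑ Class Y? (suc (suc zero))
  covered-class₂ = covered-chains (class-perm X? pX _) (class-perm Y? pY _)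
    (class₂-chain X?) (class₂-chain Y?) (X→Y _) (Y→X _)

module _ {X Y : Cells n} (X? : Decidable₂ X) (Y? : Decidable₂ Y)
  (pX : IsPartialPerm X) (pY : IsPartialPerm Y) (aX : Avoids3412 X) (aY : Avoids3412 Y)
  (X→Y : ∀ c → Covers (Class X? c) (Class Y? c)) (Y→X : ∀ c → Covers (Class Y? c) (Class X? c)) where

  -- The outermost classes are compared first, as chains; their inclusions in both directions then
  -- exclude exchanges in the other two classes.
  covered-classes : ∀ c → Class X? c ⊑ Class Y? c
  covered-classes zero = covered-class₀ X? Y? pX pY X→Y Y→X
  covered-classes (suc zero) =
    covers⇒⊑ (class-perm X? pX _) (class-perm Y? pY _) (X→Y _) (Y→X _)
      (noExchange-red X? Y? aX (covered-class₀ Y? X? pY pX Y→X X→Y))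
      (noExchange-red Y? X? aY (covered-class₀ X? Y? pX pY X→Y Y→X))
  covered-classes (suc (suc zero)) = covered-class₂ X? Y? pX pY X→Y Y→X
  covered-classes (suc (suc (suc zero))) =
    covers⇒⊑ (partialPermᵀ (class-perm X? pX _)) (partialPermᵀ (class-perm Y? pY _))
      (coversᵀ (X→Y _)) (coversᵀ (Y→X _))
      (noExchange-blue X? Y? (covered-class₂ Y? X? pY pX Y→X X→Y))
      (noExchange-blue Y? X? (covered-class₂ X? Y? pX pY X→Y Y→X))

-- Chains

-- Read from its NW end, a chain reaches Turn cells horizontally and leaves them vertically, and
-- passes vertically through Through cells; in the transpose the two directions are exchanged.
Start Turn Through : Cells n → Cells n
Start X i j = X i j × ¬ Left X i j × ¬ Up X i j
Turn X i j = X i j × Left X i j × ¬ Up X i j × ¬ Right X i j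
Through X i j = X i j × ¬ Left X i j × Up X i j × Down X i j

module _ {X : Cells n} (X? : Decidable₂ X) where

  start? : Decidable₂ (Start X)
  start? i j = X? i j ×-dec (¬? (left? X? i j) ×-dec ¬? (up? X? i j))

  turn? : Decidable₂ (Turn X)
  turn? i j = X? i j ×-dec (left? X? i j ×-dec (¬? (up? X? i j) ×-dec ¬? (right? X? i j)))

  through? : Decidable₂ (Through X)
  through? i j = X? i j ×-dec (¬? (left? X? i j) ×-dec (up? X? i j ×-dec down? X? i j))

  start-perm : IsPartialPerm (Start X)
  start-perm = record
    { row-unique = λ (x , ¬l , _) (y , ¬m , _) → upmost-unique {X = X ᵀ} x ¬l y ¬m
    ; col-unique = λ (x , _ , ¬u) (y , _ , ¬v) → upmost-unique {X = X} x ¬u y ¬v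
    }

  turn-perm : IsPartialPerm (Turn X)
  turn-perm = record
    { row-unique = λ (x , _ , _ , ¬r) (y , _ , _ , ¬s) → downmost-unique {X = X ᵀ} x ¬r y ¬s
    ; col-unique = λ (x , _ , ¬u , _) (y , _ , ¬v , _) → upmost-unique {X = X} x ¬u y ¬v
    }

module _ {X : Cells n} (X? : Decidable₂ X) (ch : Chain X) where

  chain-cases : ∀ {i j} → X i j →
    Start X i j ⊎ Turn X i j ⊎ Turn (X ᵀ) j i ⊎ Through X i j ⊎ Through (X ᵀ) j i
  chain-cases {i} {j} x with left? X? i j | up? X? i j
  -- A cell above and a cell to the left would be in NE/SW position.
  ... | yes (_ , l<j , y) | yes (_ , k<i , z) = ⊥-elim (ch k<i l<j z y)
  ... | no ¬l | no ¬u = inj₁ (x , ¬l , ¬u)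
  ... | yes l | no ¬u with right? X? i j
  ... | no ¬r = inj₂ (inj₁ (x , l , ¬u , ¬r))
  ... | yes r = inj₂ (inj₂ (inj₂ (inj₂ (x , ¬u , l , r))))
  chain-cases {i} {j} x | no ¬l | yes u with down? X? i j
  ... | no ¬d = inj₂ (inj₂ (inj₁ (x , u , ¬l , ¬d)))
  ... | yes d = inj₂ (inj₂ (inj₂ (inj₁ (x , ¬l , u , d))))

  -- A cell to the right of the top cell would be NE of the cell in row `b`, so a top cell with a
  -- cell to its left is a turn.
  column-top : ∀ {a b j} → a < b → X a j → X b j →
    ∃ λ t → (Start X t j ⊎ Turn X t j) × (t ≡ a ⊎ t < a)
  column-top {a} {b} {j} a<b x y with topmost X? x
  ... | t , z , ¬u , t≤a with left? X? t j
  ... | no ¬l = t , inj₁ (z , ¬l , ¬u) , t≤a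
  ... | yes l = t , inj₂ (z , l , ¬u , λ (_ , j<k , w) → ch (t<b t≤a) j<k w y) , t≤a
    where
    t<b : t ≡ a ⊎ t < a → t < b
    t<b (inj₁ refl) = a<b
    t<b (inj₂ t<a) = ℕ.<-trans t<a a<b

  -- A cell to the left of the bottom cell would be SW of the cell in row `a`.
  column-bottom : ∀ {a b j} → a < b → X a j → X b j →
    ∃ λ u → Turn (X ᵀ) j u × (u ≡ b ⊎ b < u)
  column-bottom {a} {b} {j} a<b x y with bottommost X? y
  ... | u , z , ¬d , b≤u =
    u , (z , (a , a<u b≤u , x) , (λ (_ , l<j , w) → ch (a<u b≤u) l<j x w) , ¬d) , b≤u
    where
    a<u : u ≡ b ⊎ b < u → a < u
    a<u (inj₁ refl) = a<b
    a<u (inj₂ b<u) = ℕ.<-trans a<b b<u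

-- Starts and turns of both kinds comprise the ends of all straight pieces of at least two cells of
-- a chain.
record Aligned (X Y : Cells n) : Set where
  field
    start  : Start X ⊑ Start Y
    turn  : Turn X ⊑ Turn Y
    turnᵀ : Turn (X ᵀ) ⊑ Turn (Y ᵀ)
open Aligned

start-swap : {X : Cells n} → Start X ⊑ Start (X ᵀ) ᵀ
start-swap (x , ¬l , ¬u) = x , ¬u , ¬l

alignedᵀ : {X Y : Cells n} → Aligned X Y → Aligned (X ᵀ) (Y ᵀ)
alignedᵀ {X = X} {Y} al = record
  { start  = λ c → start-swap {X = Y} (start al (start-swap {X = X ᵀ} c))
  ; turn  = turnᵀ al
  ; turnᵀ = turn al
  }

Between : Cells n → Cells n
Between X i j = Up X i j × Down X i j

-- The ends of the column pieces of X lie in Y, and Y, being a chain, can straddle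
-- a given row in one column only.
between-unique : {X Y : Cells n} → Decidable₂ X → Chain X → Chain Y → Aligned X Y →
  ∀ {i j k} → Between X i j → Between Y i k → j ≡ k
between-unique {X = X} {Y} X? chX chY al {i} {j} {k}
  ((a , a<i , x) , (b , i<b , x′)) ((a′ , a′<i , y) , (b′ , i<b′ , y′))
  with column-top X? chX (ℕ.<-trans a<i i<b) x x′ | column-bottom X? chX (ℕ.<-trans a<i i<b) x x′
... | t , top , t≤a | u , bot , b≤u with <-cmp j k
... | tri≈ _ e _ = e
... | tri< j<k _ _ = ⊥-elim (chY (ℕ.<-trans a′<i (i<u b≤u)) j<k y (proj₁ (turnᵀ al bot)))
  where
  i<u : u ≡ b ⊎ b < u → i < u
  i<u (inj₁ refl) = i<b
  i<u (inj₂ b<u) = ℕ.<-trans i<b b<u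
... | tri> _ _ k<j = ⊥-elim (chY (ℕ.<-trans (t<i t≤a) i<b′) k<j (Yt top) y′)
  where
  t<i : t ≡ a ⊎ t < a → t < i
  t<i (inj₁ refl) = a<i
  t<i (inj₂ t<a) = ℕ.<-trans t<a a<i
  Yt : Start X t j ⊎ Turn X t j → Y t j
  Yt (inj₁ c) = proj₁ (start al c)
  Yt (inj₂ e) = proj₁ (turn al e)

-- Labels

module _ {P : Fin n → Fin m → Set} (P? : ∀ j c → Dec (P j c)) where

  occurs? : Dec (∃ λ c → ∃ λ j → P j c)
  occurs? = any? λ c → any? λ j → P? j c

  -- Only the class is kept, not the position of the cell; `zero` stands for a line without a cell
  -- of any class.
  label : Fin (suc m)
  label with occurs?
  ... | yes (c , _) = suc c
  ... | no _        = zero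

  label-complete : (∀ {j k c d} → P j c → P k d → c ≡ d) → ∀ {j c} → P j c → label ≡ suc c
  label-complete ex p with occurs?
  ... | yes (_ , _ , q) = cong suc (ex q p)
  ... | no ¬q = contradiction (_ , _ , p) ¬q

  label-sound : ∀ {c} → label ≡ suc c → ∃ λ j → P j c
  label-sound e with occurs?
  label-sound refl | yes (_ , q) = q

label-transfer : {P Q : Fin n → Fin m → Set} (P? : ∀ j c → Dec (P j c)) (Q? : ∀ j c → Dec (Q j c)) →
  (∀ {j k c d} → P j c → P k d → c ≡ d) → label P? ≡ label Q? →
  ∀ {j c} → P j c → ∃ λ k → Q k c
label-transfer P? Q? ex e p = label-sound Q? (trans (sym e) (label-complete P? ex p))

_≟ᵉ_ : (x y : Entry) → Dec (x ≡ y)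
e0  ≟ᵉ e0  = yes refl
e0  ≟ᵉ e1  = no λ ()
e0  ≟ᵉ em1 = no λ ()
e1  ≟ᵉ e0  = no λ ()
e1  ≟ᵉ e1  = yes refl
e1  ≟ᵉ em1 = no λ ()
em1 ≟ᵉ e0  = no λ ()
em1 ≟ᵉ e1  = no λ ()
em1 ≟ᵉ em1 = yes refl

-- `NE` and `MidOne` both concern the rightmost 1 of a row, so one slot of the row label serves
-- both. A 1 with further 1s on both sides in its row is left to `MidOne` of the transpose.
One Neg NE MidOne : Matrix n → Cells n
One A i j = A i j ≡ e1
Neg A i j = A i j ≡ em1
NE A i j = One A i j × ¬ Right (One A) i j × ¬ Up (One A) i j
MidOne A i j = One A i j × ¬ Right (One A) i j × Between (One A) i j

module _ (A : Matrix n) where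

  one? : Decidable₂ (One A)
  one? i j = A i j ≟ᵉ e1

  neg? : Decidable₂ (Neg A)
  neg? i j = A i j ≟ᵉ em1

  NE? : Decidable₂ (NE A)
  NE? i j = one? i j ×-dec (¬? (right? one? i j) ×-dec ¬? (up? one? i j))

  midOne? : Decidable₂ (MidOne A)
  midOne? i j = one? i j ×-dec (¬? (right? one? i j) ×-dec (up? one? i j ×-dec down? one? i j))

  NE-perm : IsPartialPerm (NE A)
  NE-perm = record
    { row-unique = λ (x , ¬r , _) (y , ¬s , _) → downmost-unique {X = One A ᵀ} x ¬r y ¬s
    ; col-unique = λ (x , _ , ¬u) (y , _ , ¬v) → upmost-unique {X = One A} x ¬u y ¬v
    }

module _ (A : Matrix n) where

  -- Each slot describes one extreme entry of row `i`: in order, the rightmost 1, the leftmost 1,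
  -- the leftmost -1 and the rightmost -1.
  Slot₁ : Fin n → Fin n → Fin 5 → Set
  Slot₁ i j zero    = MidOne A i j
  Slot₁ i j (suc c) = Class (NE? A) c i j

  -- An NE cell of the transpose is a one that is leftmost in its row and lowest in its column.
  Slot₂ : Fin n → Fin n → Fin 4 → Set
  Slot₂ i j c = Class (NE? (A ᵀ)) c j i

  Slot₃ : Fin n → Fin n → Fin 3 → Set
  Slot₃ i j zero             = Start (Neg A) i j
  Slot₃ i j (suc zero)       = Turn (Neg A ᵀ) j i
  Slot₃ i j (suc (suc zero)) = Through (Neg A) i j

  Slot₄ : Fin n → Fin n → Fin 1 → Set
  Slot₄ i j zero = Turn (Neg A) i j

module _ (A : Matrix n) where

  slot₁? : ∀ i j c → Dec (Slot₁ A i j c)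
  slot₁? i j zero    = midOne? A i j
  slot₁? i j (suc c) = Shading.Class? (NE? A) c i j

  slot₂? : ∀ i j c → Dec (Slot₂ A i j c)
  slot₂? i j c = Shading.Class? (NE? (A ᵀ)) c j i

  slot₃? : ∀ i j c → Dec (Slot₃ A i j c)
  slot₃? i j zero             = start? (neg? A) i j
  slot₃? i j (suc zero)       = turn? (neg? (A ᵀ)) j i
  slot₃? i j (suc (suc zero)) = through? (neg? A) i j

  slot₄? : ∀ i j c → Dec (Slot₄ A i j c)
  slot₄? i j zero = turn? (neg? A) i j

  slot₁-exclusive : ∀ {i j k c d} → Slot₁ A i j c → Slot₁ A i k d → c ≡ d
  slot₁-exclusive {c = zero} {zero} _ _ = refl
  slot₁-exclusive {c = zero} {suc d} (x , ¬r , u , _) ((y , ¬s , ¬v) , _)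
    with refl ← downmost-unique {X = One A ᵀ} x ¬r y ¬s = contradiction u ¬v
  slot₁-exclusive {c = suc c} {zero} ((y , ¬s , ¬v) , _) (x , ¬r , u , _)
    with refl ← downmost-unique {X = One A ᵀ} x ¬r y ¬s = contradiction u ¬v
  slot₁-exclusive {c = suc c} {suc d} (x , e) (y , e′)
    with refl ← row-unique (NE-perm A) x y = cong suc (trans (sym e) e′)

  slot₂-exclusive : ∀ {i j k c d} → Slot₂ A i j c → Slot₂ A i k d → c ≡ d
  slot₂-exclusive (x , e) (y , e′) with refl ← col-unique (NE-perm (A ᵀ)) x y = trans (sym e) e′

  -- All three classes concern the leftmost -1 of the row; the presence of -1s above and below it
  -- tells them apart.
  slot₃-exclusive : ∀ {i j k c d} → Slot₃ A i j c → Slot₃ A i k d → c ≡ d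
  slot₃-exclusive {c = zero} {zero} _ _ = refl
  slot₃-exclusive {c = zero} {suc zero} (x , ¬l , ¬u) (y , v , ¬m , _)
    with refl ← upmost-unique {X = Neg A ᵀ} x ¬l y ¬m = contradiction v ¬u
  slot₃-exclusive {c = zero} {suc (suc zero)} (x , ¬l , ¬u) (y , ¬m , v , _)
    with refl ← upmost-unique {X = Neg A ᵀ} x ¬l y ¬m = contradiction v ¬u
  slot₃-exclusive {c = suc zero} {zero} (y , v , ¬m , _) (x , ¬l , ¬u)
    with refl ← upmost-unique {X = Neg A ᵀ} x ¬l y ¬m = contradiction v ¬u
  slot₃-exclusive {c = suc zero} {suc zero} _ _ = refl
  slot₃-exclusive {c = suc zero} {suc (suc zero)} (x , _ , ¬l , ¬d) (y , ¬m , _ , d)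
    with refl ← upmost-unique {X = Neg A ᵀ} x ¬l y ¬m = contradiction d ¬d
  slot₃-exclusive {c = suc (suc zero)} {zero} (y , ¬m , v , _) (x , ¬l , ¬u)
    with refl ← upmost-unique {X = Neg A ᵀ} x ¬l y ¬m = contradiction v ¬u
  slot₃-exclusive {c = suc (suc zero)} {suc zero} (y , ¬m , _ , d) (x , _ , ¬l , ¬d)
    with refl ← upmost-unique {X = Neg A ᵀ} x ¬l y ¬m = contradiction d ¬d
  slot₃-exclusive {c = suc (suc zero)} {suc (suc zero)} _ _ = refl

  slot₄-exclusive : ∀ {i j k c d} → Slot₄ A i j c → Slot₄ A i k d → c ≡ d
  slot₄-exclusive {c = zero} {zero} _ _ = refl

  rowLabel : Fin n → Fin 240
  -- Each slot has one extra value for an absent cell, which gives 6 · 5 · 4 · 2 = 240; 40 and 8 are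
  -- the partial products from the right.
  rowLabel i = combine {6} {40} (label (slot₁? i))
    (combine {5} {8} (label (slot₂? i)) (combine {4} {2} (label (slot₃? i)) (label (slot₄? i))))

record RowsTransfer (A B : Matrix n) : Set where
  field
    t₁ : ∀ {i j c} → Slot₁ A i j c → ∃ λ k → Slot₁ B i k c
    t₂ : ∀ {i j c} → Slot₂ A i j c → ∃ λ k → Slot₂ B i k c
    t₃ : ∀ {i j c} → Slot₃ A i j c → ∃ λ k → Slot₃ B i k c
    t₄ : ∀ {i j c} → Slot₄ A i j c → ∃ λ k → Slot₄ B i k c
open RowsTransfer

rowLabel-transfer : (A B : Matrix n) → (∀ i → rowLabel A i ≡ rowLabel B i) → RowsTransfer A B
rowLabel-transfer A B eq = record
  { t₁ = λ {i} → label-transfer (slot₁? A i) (slot₁? B i) (slot₁-exclusive A) (proj₁ (split i))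
  ; t₂ = λ {i} → label-transfer (slot₂? A i) (slot₂? B i) (slot₂-exclusive A) (proj₁ (split₂ i))
  ; t₃ = λ {i} → label-transfer (slot₃? A i) (slot₃? B i) (slot₃-exclusive A) (proj₁ (split₃ i))
  ; t₄ = λ {i} → label-transfer (slot₄? A i) (slot₄? B i) (slot₄-exclusive A) (proj₂ (split₃ i))
  }
  where
  split = λ i → combine-injective {6} {40} _ _ _ _ (eq i)
  split₂ = λ i → combine-injective {5} {8} _ _ _ _ (proj₂ (split i))
  split₃ = λ i → combine-injective {4} {2} _ _ _ _ (proj₂ (split₂ i))

code : Matrix n → Fin n → Fin 62208
code A i = inject≤ (combine {240} {240} (rowLabel A i) (rowLabel (A ᵀ) i)) (toWitness {a? = 57600 ℕ.≤? 62208} _)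

code-injective : (A B : Matrix n) → (∀ i → code A i ≡ code B i) →
  RowsTransfer A B × RowsTransfer (A ᵀ) (B ᵀ)
code-injective A B eq =
  rowLabel-transfer A B (proj₁ ∘ split) , rowLabel-transfer (A ᵀ) (B ᵀ) (proj₂ ∘ split)
  where
  split = λ i → combine-injective {240} {240} _ _ _ _ (inject≤-injective _ _ _ _ (eq i))

-- Alternating sequences

StartsWithout : Entry → (Fin n → Entry) → Set
StartsWithout e s = ∀ p → (∀ q → q < p → s q ≡ e0) → s p ≢ e

alternating-tail : {s : Fin (suc n) → Entry} → Alternating s → Alternating (s ∘ suc)
alternating-tail alt j k j<k sj sk z =
  alt (suc j) (suc k) (s<s j<k) sj sk λ { (suc l) j<l l<k → z l (s<s⁻¹ j<l) (s<s⁻¹ l<k) }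

startsWithout-tail : ∀ {e} {s : Fin (suc n) → Entry} → s zero ≡ e0 → StartsWithout e s → StartsWithout e (s ∘ suc)
startsWithout-tail z sw p zs = sw (suc p) λ { zero _ → z ; (suc q) q<p → zs q (s<s⁻¹ q<p) }

alternating⇒startsWithout : ∀ {e} {s : Fin (suc n) → Entry} → Alternating s →
  s zero ≡ e → NonZero e → StartsWithout e (s ∘ suc)
alternating⇒startsWithout {s = s} alt refl nz p zs sp =
  alt zero (suc p) z<s nz (λ z → nz (trans (sym sp) z))
    (λ { (suc l) _ l<p → zs l (s<s⁻¹ l<p) }) (sym sp)

-- Past a nonzero entry the forbidden next sign changes, so each of the two statements recurs into
-- the other.
sum-startsWithout-e1 : (s : Fin n → Entry) → Alternating s → StartsWithout e1 s →
  sumFin n (val ∘ s) ≡ + 0 ⊎ sumFin n (val ∘ s) ≡ -[1+ 0 ]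
sum-startsWithout-em1 : (s : Fin n → Entry) → Alternating s → StartsWithout em1 s →
  sumFin n (val ∘ s) ≡ + 0 ⊎ sumFin n (val ∘ s) ≡ + 1
sum-startsWithout-e1 {zero} s alt sw = inj₁ refl
sum-startsWithout-e1 {suc n} s alt sw with s zero in e
... | e1 = contradiction e (sw zero λ _ ())
... | e0 with sum-startsWithout-e1 (s ∘ suc) (alternating-tail alt) (startsWithout-tail e sw)
... | inj₁ h = inj₁ (cong (_+_ (+ 0)) h)
... | inj₂ h = inj₂ (cong (_+_ (+ 0)) h)
sum-startsWithout-e1 {suc n} s alt sw | em1
  with sum-startsWithout-em1 (s ∘ suc) (alternating-tail alt) (alternating⇒startsWithout alt e λ ())
... | inj₁ h = inj₂ (cong (_+_ -[1+ 0 ]) h)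
... | inj₂ h = inj₁ (cong (_+_ -[1+ 0 ]) h)
sum-startsWithout-em1 {zero} s alt sw = inj₁ refl
sum-startsWithout-em1 {suc n} s alt sw with s zero in e
... | em1 = contradiction e (sw zero λ _ ())
... | e0 with sum-startsWithout-em1 (s ∘ suc) (alternating-tail alt) (startsWithout-tail e sw)
... | inj₁ h = inj₁ (cong (_+_ (+ 0)) h)
... | inj₂ h = inj₂ (cong (_+_ (+ 0)) h)
sum-startsWithout-em1 {suc n} s alt sw | e1
  with sum-startsWithout-e1 (s ∘ suc) (alternating-tail alt) (alternating⇒startsWithout alt e λ ())
... | inj₁ h = inj₂ (cong (_+_ (+ 1)) h)
... | inj₂ h = inj₁ (cong (_+_ (+ 1)) h)

record IsASMLine (s : Fin n → Entry) : Set where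
  field
    total       : sumFin n (val ∘ s) ≡ + 1
    alternating : Alternating s
open IsASMLine

-- With no 1 before the -1 at `p`, the first nonzero entry of the line is not 1, and the sum is at
-- most 0.
one-before-neg : {s : Fin n → Entry} → IsASMLine s → ∀ {p} → s p ≡ em1 → ∃ λ k → k < p × s k ≡ e1
one-before-neg {s = s} line {p} sp with any? (λ k → (k <? p) ×-dec (s k ≟ᵉ e1))
... | yes k = k
... | no ¬k = [ no-total , no-total′ ]′ (sum-startsWithout-e1 s (alternating line) sw)
  where
  no-total : sumFin _ (val ∘ s) ≡ + 0 → _
  no-total h with () ← trans (sym h) (total line)
  no-total′ : sumFin _ (val ∘ s) ≡ -[1+ 0 ] → _
  no-total′ h with () ← trans (sym h) (total line)
  sw : StartsWithout e1 s
  sw q zs sq with <-cmp q p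
  ... | tri< q<p _ _ = ¬k (q , q<p , sq)
  ... | tri≈ _ refl _ with () ← trans (sym sp) sq
  sw q zs sq | tri> _ _ p<q with () ← trans (sym sp) (zs p p<q)

opposite-anti : {i j : Fin n} → i < j → opposite j < opposite i
opposite-anti {n} {i} {j} i<j =
  subst₂ _<ⁿ_ (sym (opposite-prop j)) (sym (opposite-prop i)) (ℕ.∸-monoʳ-< (s<s i<j) (toℕ<n j))

opposite-anti⁻ˡ : {i j : Fin n} → opposite i < j → opposite j < i
opposite-anti⁻ˡ {i = i} {j} p = subst (opposite j <_) (opposite-involutive i) (opposite-anti p)

opposite-anti⁻ʳ : {i j : Fin n} → i < opposite j → j < opposite i
opposite-anti⁻ʳ {i = i} {j} p = subst (_< opposite i) (opposite-involutive j) (opposite-anti p)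

sumFin≡sum : ∀ n (f : Fin n → ℤ) → sumFin n f ≡ sum f
sumFin≡sum zero    f = refl
sumFin≡sum (suc n) f = cong (_+_ (f zero)) (sumFin≡sum n (f ∘ suc))

sumFin-opposite : ∀ n (f : Fin n → ℤ) → sumFin n (f ∘ opposite) ≡ sumFin n f
sumFin-opposite n f =
  trans (sumFin≡sum n _) (trans (sym (sum-permute f reverse)) (sym (sumFin≡sum n f)))

alternating-opposite : {s : Fin n → Entry} → Alternating s → Alternating (s ∘ opposite)
alternating-opposite {s = s} alt j k j<k sj sk z e =
  alt (opposite k) (opposite j) (opposite-anti j<k) sk sj
    (λ l k<l l<j → trans (cong s (sym (opposite-involutive l)))
      (z (opposite l) (opposite-anti⁻ʳ l<j) (opposite-anti⁻ˡ k<l)))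
    (sym e)

line-opposite : {s : Fin n → Entry} → IsASMLine s → IsASMLine (s ∘ opposite)
line-opposite {n} {s} line = record
  { total       = trans (sumFin-opposite n (val ∘ s)) (total line)
  ; alternating = alternating-opposite (alternating line)
  }

one-after-neg : {s : Fin n → Entry} → IsASMLine s → ∀ {p} → s p ≡ em1 → ∃ λ k → p < k × s k ≡ e1
one-after-neg {s = s} line {p} sp
  with one-before-neg (line-opposite line) {opposite p} (trans (cong s (opposite-involutive p)) sp)
... | k , k<p , sk = opposite k , opposite-anti⁻ʳ k<p , sk

-- A 1 found strictly between replaces the right end `k`. If every entry between is 0, two
-- consecutive 1s contradict alternation.
neg-between-ones : {s : Fin n → Entry} → IsASMLine s → ∀ {j k} → j < k → s j ≡ e1 → s k ≡ e1 →
  ∃ λ l → (j < l × l < k) × s l ≡ em1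
neg-between-ones {s = s} line {j} {k} = go (<-wellFounded k)
  where
  go : ∀ {k} → Acc _<_ k → j < k → s j ≡ e1 → s k ≡ e1 → ∃ λ l → (j < l × l < k) × s l ≡ em1
  go {k} (acc rs) j<k sj sk with any? (λ l → ((j <? l) ×-dec (l <? k)) ×-dec ¬? (s l ≟ᵉ e0))
  ... | no ¬l = contradiction (trans sj (sym sk)) (alternating line j k j<k (one≢0 sj) (one≢0 sk) zs)
    where
    one≢0 : ∀ {x} → x ≡ e1 → NonZero x
    one≢0 refl ()
    zs : ∀ l → j < l → l < k → s l ≡ e0
    zs l j<l l<k with s l in e
    ... | e0  = refl
    ... | e1  = contradiction (l , (j<l , l<k) , one≢0 e) ¬l
    ... | em1 = contradiction (l , (j<l , l<k) , λ z → em1≢0 (trans (sym e) z)) ¬l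
      where
      em1≢0 : em1 ≢ e0
      em1≢0 ()
  ... | yes (l , (j<l , l<k) , nz) with s l in e
  ... | e0  = contradiction refl nz
  ... | em1 = l , (j<l , l<k) , e
  ... | e1 with go (rs l<k) j<l sj e
  ... | l′ , (j<l′ , l′<l) , e′ = l′ , (j<l′ , ℕ.<-trans l′<l l<k) , e′

-- Alternating sign matrices avoiding 3412

-- Both patterns are reduced to this form. It is stable under transposition, so each argument about
-- rows also serves for columns.
record Good (A : Matrix n) : Set where
  field
    asm    : IsASM A
    avoids : Avoids3412 (One A)

  rowLine : ∀ i → IsASMLine (A i)
  rowLine i = record { total = IsASM.rowSum asm i ; alternating = IsASM.rowAlt asm i }

  colLine : ∀ j → IsASMLine (λ i → A i j)
  colLine j = record { total = IsASM.colSum asm j ; alternating = IsASM.colAlt asm j }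

  -- The ones above and right of the upper right −1, and those left of and below the
  -- lower left −1, form a 3412.
  neg-chain : Chain (Neg A)
  neg-chain {i} {j} {k} {l} i<k l<j x y
    with one-before-neg (colLine j) x | one-after-neg (rowLine i) x
       | one-before-neg (rowLine k) y | one-after-neg (colLine l) y
  ... | a , a<i , u | b , j<b , v | c , c<l , w | d , k<d , z =
    avoids a<i i<k k<d c<l l<j j<b u v w z

  right-neg : ∀ {i j} → One A i j → Right (One A) i j → Right (Neg A) i j
  right-neg {i} x (k , j<k , y) with neg-between-ones (rowLine i) j<k x y
  ... | l , (j<l , _) , z = l , j<l , z

  up-neg : ∀ {i j} → One A i j → Up (One A) i j → Up (Neg A) i j
  up-neg {j = j} x (k , k<i , y) with neg-between-ones (colLine j) k<i y x
  ... | l , (_ , l<i) , z = l , l<i , z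

  down-neg : ∀ {i j} → One A i j → Down (One A) i j → Down (Neg A) i j
  down-neg {j = j} x (k , i<k , y) with neg-between-ones (colLine j) i<k x y
  ... | l , (i<l , _) , z = l , i<l , z

  left-neg : ∀ {i j} → One A i j → Left (One A) i j → Left (Neg A) i j
  left-neg {i} x (k , k<j , y) with neg-between-ones (rowLine i) k<j y x
  ... | l , (_ , l<j) , z = l , l<j , z

  -- The -1s that separate the 1 from those to its right and below would be in NE/SW position;
  -- likewise for `¬left-up`.
  ¬right-down : ∀ {i j} → One A i j → Right (One A) i j → ¬ Down (One A) i j
  ¬right-down x r d with right-neg x r | down-neg x d
  ... | _ , j<k , y | _ , i<l , z = neg-chain i<l j<k y z

  ¬left-up : ∀ {i j} → One A i j → Left (One A) i j → ¬ Up (One A) i j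
  ¬left-up x l u with left-neg x l | up-neg x u
  ... | _ , k<j , y | _ , l<i , z = neg-chain l<i k<j z y

  -- A 1 with another to its right is lowest in its column, and a 1 with another above it is
  -- leftmost in its row. It remains to see whether further 1s lie on the opposite side.
  one-cases : ∀ {i j} → One A i j →
    NE A i j ⊎ NE (A ᵀ) j i ⊎ MidOne A i j ⊎ MidOne (A ᵀ) j i
  one-cases {i} {j} x with right? (one? A) i j
  one-cases {i} {j} x | yes r with left? (one? A) i j
  ... | no ¬l = inj₂ (inj₁ (x , ¬right-down x r , ¬l))
  ... | yes l = inj₂ (inj₂ (inj₂ (x , ¬right-down x r , l , r)))
  one-cases {i} {j} x | no ¬r with up? (one? A) i j
  ... | no ¬u = inj₁ (x , ¬r , ¬u)
  ... | yes u with down? (one? A) i j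
  ... | no ¬d = inj₂ (inj₁ (x , ¬d , λ l → ¬left-up x l u))
  ... | yes d = inj₂ (inj₂ (inj₁ (x , ¬r , u , d)))
open Good

goodᵀ : {A : Matrix n} → Good A → Good (A ᵀ)
goodᵀ g = record
  { asm = record
    { rowSum = IsASM.colSum (asm g)
    ; colSum = IsASM.rowSum (asm g)
    ; rowAlt = IsASM.colAlt (asm g)
    ; colAlt = IsASM.rowAlt (asm g)
    }
  ; avoids = avoids3412ᵀ (avoids g)
  }

-- Recovering the matrix from its labels

LinesTransfer : (A B : Matrix n) → Set
LinesTransfer A B = RowsTransfer A B × RowsTransfer (A ᵀ) (B ᵀ)

linesᵀ : {A B : Matrix n} → LinesTransfer A B → LinesTransfer (A ᵀ) (B ᵀ)
linesᵀ (r , c) = c , r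

covers-start : {A B : Matrix n} → LinesTransfer A B → Covers (Start (Neg A)) (Start (Neg B))
covers-start {A = A} {B} (r , c) = record
  { row = t₃ r {c = zero}
  ; col = λ x → let (k , y) = t₃ c {c = zero} (start-swap {X = Neg A} x)
                in k , start-swap {X = Neg (B ᵀ)} y
  }

-- A turn sits in `Slot₄` of its row. Since `Slot₃` looks at turns of the transpose, the label of
-- its column, taken in the transposed matrix, shows it there.
covers-turn : {A B : Matrix n} → LinesTransfer A B → Covers (Turn (Neg A)) (Turn (Neg B))
covers-turn (r , c) = record { row = t₄ r {c = zero} ; col = t₃ c {c = suc zero} }

covers-class : {A B : Matrix n} → LinesTransfer A B →
  ∀ c → Covers (Class (NE? A) c) (Class (NE? B) c)
covers-class (r , c) s = record { row = t₁ r {c = suc s} ; col = t₂ c }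

module _ {A B : Matrix n} (gA : Good A) (gB : Good B)
  (A→B : LinesTransfer A B) (B→A : LinesTransfer B A) where

  turn-transfer : Turn (Neg A) ⊑ Turn (Neg B)
  turn-transfer = covered-chains (turn-perm (neg? A)) (turn-perm (neg? B))
    (chain-⊑ proj₁ (neg-chain gA)) (chain-⊑ proj₁ (neg-chain gB)) (covers-turn A→B) (covers-turn B→A)

  start-transfer : Start (Neg A) ⊑ Start (Neg B)
  start-transfer = covered-chains (start-perm (neg? A)) (start-perm (neg? B))
    (chain-⊑ proj₁ (neg-chain gA)) (chain-⊑ proj₁ (neg-chain gB)) (covers-start A→B) (covers-start B→A)

  NE-transfer : ∀ {i j} → NE A i j → One B i j
  NE-transfer x = proj₁ (proj₁ (covered-classes (NE? A) (NE? B) (NE-perm A) (NE-perm B)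
    (avoids3412-⊑ proj₁ (avoids gA)) (avoids3412-⊑ proj₁ (avoids gB))
    (covers-class A→B) (covers-class B→A) _ (x , refl)))

neg-aligned : {A B : Matrix n} → Good A → Good B → LinesTransfer A B → LinesTransfer B A →
  Aligned (Neg A) (Neg B)
neg-aligned gA gB A→B B→A = record
  { start = start-transfer gA gB A→B B→A
  ; turn  = turn-transfer gA gB A→B B→A
  ; turnᵀ = turn-transfer (goodᵀ gA) (goodᵀ gB) (linesᵀ A→B) (linesᵀ B→A)
  }

module _ {A B : Matrix n} (gA : Good A) (gB : Good B)
  (A→B : LinesTransfer A B) (al : Aligned (Neg A) (Neg B)) where

  -- The label of row `i` promises a through cell of `B` in some column `k`. Both chains straddle
  -- row `i`, in columns `j` and `k`, so `between-unique` identifies the two.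
  through-transfer : ∀ {i j} → Through (Neg A) i j → Neg B i j
  through-transfer x@(_ , _ , b) with t₃ (proj₁ A→B) {c = suc (suc zero)} x
  ... | k , y , _ , b′
    with refl ← between-unique (neg? A) (neg-chain gA) (neg-chain gB) al b b′ = y

  -- As for through cells, with the straddling -1s supplied by `up-neg` and `down-neg`.
  midOne-transfer : ∀ {i j} → MidOne A i j → One B i j
  midOne-transfer x@(a , _ , u , d) with t₁ (proj₁ A→B) {c = zero} x
  ... | k , y , _ , v , e
    with refl ← between-unique (neg? A) (neg-chain gA) (neg-chain gB) al
           (up-neg gA a u , down-neg gA a d) (up-neg gB y v , down-neg gB y e) = y

module _ {A B : Matrix n} (gA : Good A) (gB : Good B)
  (A→B : LinesTransfer A B) (B→A : LinesTransfer B A) where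

  private
    al : Aligned (Neg A) (Neg B)
    al = neg-aligned gA gB A→B B→A

  neg-transfer : ∀ {i j} → Neg A i j → Neg B i j
  neg-transfer x with chain-cases (neg? A) (neg-chain gA) x
  ... | inj₁ c                      = proj₁ (start al c)
  ... | inj₂ (inj₁ t)               = proj₁ (turn al t)
  ... | inj₂ (inj₂ (inj₁ t))        = proj₁ (turnᵀ al t)
  ... | inj₂ (inj₂ (inj₂ (inj₁ p))) = through-transfer gA gB A→B al p
  ... | inj₂ (inj₂ (inj₂ (inj₂ p))) = through-transfer (goodᵀ gA) (goodᵀ gB) (linesᵀ A→B) (alignedᵀ al) p

  one-transfer : ∀ {i j} → One A i j → One B i j
  one-transfer x with one-cases gA x
  ... | inj₁ p               = NE-transfer gA gB A→B B→A p
  ... | inj₂ (inj₁ p)        = NE-transfer (goodᵀ gA) (goodᵀ gB) (linesᵀ A→B) (linesᵀ B→A) p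
  ... | inj₂ (inj₂ (inj₁ p)) = midOne-transfer gA gB A→B al p
  ... | inj₂ (inj₂ (inj₂ p)) = midOne-transfer (goodᵀ gA) (goodᵀ gB) (linesᵀ A→B) (alignedᵀ al) p

entry-≡ : {x y : Entry} → (x ≡ e1 → y ≡ e1) → (x ≡ em1 → y ≡ em1) →
  (y ≡ e1 → x ≡ e1) → (y ≡ em1 → x ≡ em1) → x ≡ y
entry-≡ {e1}       f g f′ g′ = sym (f refl)
entry-≡ {em1}      f g f′ g′ = sym (g refl)
entry-≡ {e0} {e0}  f g f′ g′ = refl
entry-≡ {e0} {e1}  f g f′ g′ = f′ refl
entry-≡ {e0} {em1} f g f′ g′ = g′ refl

code-determines : (A B : Matrix n) → Good A → Good B → (∀ i → code A i ≡ code B i) → A ≈M B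
code-determines A B gA gB eq i j = entry-≡
  (one-transfer gA gB A→B B→A) (neg-transfer gA gB A→B B→A)
  (one-transfer gB gA B→A A→B) (neg-transfer gB gA B→A A→B)
  where
  A→B = code-injective A B eq
  B→A = code-injective B A (sym ∘ eq)

encode : Matrix n → Fin (62208 ^ n)
encode A = funToFin (code A)

encode-injective : (A B : Matrix n) → Good A → Good B → encode A ≡ encode B → A ≈M B
encode-injective A B gA gB eq = code-determines A B gA gB λ i →
  trans (sym (finToFun-funToFin (code A) i))
    (trans (cong (λ x → finToFun x i) eq) (finToFun-funToFin (code B) i))

-- Patterns

four : {X : Set} → X → X → X → X → Fin 4 → X
four a b c d zero                   = a
four a b c d (suc zero)             = b
four a b c d (suc (suc zero))       = c
four a b c d (suc (suc (suc zero))) = d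

four-increasing : {a b c d : Fin n} → a < b → b < c → c < d → Increasing (four a b c d)
four-increasing p q r zero (suc zero) _ = p
four-increasing p q r zero (suc (suc zero)) _ = ℕ.<-trans p q
four-increasing p q r zero (suc (suc (suc zero))) _ = ℕ.<-trans p (ℕ.<-trans q r)
four-increasing p q r (suc zero) (suc (suc zero)) _ = q
four-increasing p q r (suc zero) (suc (suc (suc zero))) _ = ℕ.<-trans q r
four-increasing p q r (suc (suc zero)) (suc (suc (suc zero))) _ = r
four-increasing p q r (suc zero) (suc zero) (s<s ())
four-increasing p q r (suc (suc zero)) (suc zero) (s<s ())
four-increasing p q r (suc (suc zero)) (suc (suc zero)) (s<s (s<s ()))
four-increasing p q r (suc (suc (suc zero))) (suc zero) (s<s ())
four-increasing p q r (suc (suc (suc zero))) (suc (suc zero)) (s<s (s<s ()))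
four-increasing p q r (suc (suc (suc zero))) (suc (suc (suc zero))) (s<s (s<s (s<s ())))

avoids-3412⇒good : {A : Matrix n} → InASMAvoiding n p3412 A → Good A
avoids-3412⇒good (isASM , av) = record
  { asm    = isASM
  ; avoids = λ {r₀} {r₁} {r₂} {r₃} {c₀} {c₁} {c₂} {c₃} r₀₁ r₁₂ r₂₃ c₀₁ c₁₂ c₂₃ x₀ x₁ x₂ x₃ →
      av (four r₀ r₁ r₂ r₃ , four c₀ c₁ c₂ c₃ ,
          four-increasing r₀₁ r₁₂ r₂₃ , four-increasing c₀₁ c₁₂ c₂₃ ,
          λ { zero → x₀ ; (suc zero) → x₁ ; (suc (suc zero)) → x₂ ; (suc (suc (suc zero))) → x₃ })
  }

mirror : Matrix n → Matrix n
mirror A i j = A i (opposite j)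

mirror-asm : {A : Matrix n} → IsASM A → IsASM (mirror A)
mirror-asm {A = A} isASM = record
  { rowSum = λ i → trans (sumFin-opposite _ (val ∘ A i)) (IsASM.rowSum isASM i)
  ; colSum = IsASM.colSum isASM ∘ opposite
  ; rowAlt = λ i → alternating-opposite (IsASM.rowAlt isASM i)
  ; colAlt = IsASM.colAlt isASM ∘ opposite
  }

mirror-contains : {A : Matrix n} → Contains (mirror A) p3412 → Contains A p2143
mirror-contains {A = A} (f , g , f↑ , g↑ , ones) =
  -- `opposite` after `p2143` is `p3412`. Reversing both the index and the value keeps the column
  -- map increasing.
  f , opposite ∘ g ∘ opposite , f↑ , (λ i j i<j → opposite-anti (g↑ _ _ (opposite-anti i<j))) ,
  λ { zero → ones zero ; (suc zero) → ones (suc zero) ; (suc (suc zero)) → ones (suc (suc zero))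
    ; (suc (suc (suc zero))) → ones (suc (suc (suc zero))) }

avoids-2143⇒good : {A : Matrix n} → InASMAvoiding n p2143 A → Good (mirror A)
avoids-2143⇒good {A = A} (isASM , av) = avoids-3412⇒good (mirror-asm isASM , av ∘ mirror-contains {A = A})

theorem1p3 : (n : ℕ) →
    CardAtMost (InASMAvoiding n p3412) (62208 ^ n)
    × CardAtMost (InASMAvoiding n p2143) (62208 ^ n)
theorem1p3 n =
  (encode , λ A B a b → encode-injective A B (avoids-3412⇒good a) (avoids-3412⇒good b)) ,
  (encode ∘ mirror , λ A B a b eq i j →
    subst (λ k → A i k ≡ B i k) (opposite-involutive j)
      (encode-injective (mirror A) (mirror B) (avoids-2143⇒good a) (avoids-2143⇒good b) eq i (opposite j)))
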